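{- Let $G$ be a graph with $\chi_{st}(G)=k$. Then $\chi'_{\mathrm{inj}}(G)\leq \frac{k(k-1)}{2}$.
   Context: All graphs are finite and simple. A star coloring of $G$ is a proper vertex coloring of $G$ such that the union of any two color classes induces a star forest in $G$, i.e. every component of the induced subgraph is a star. The star chromatic number $\chi_{st}(G)$ is the smallest integer $k$ for which $G$ admits a star coloring with $k$ colors. Three edges $e_1,e_2,e_3$ of a graph are consecutive if they form (in this order) a path of length three or a cycle of length three. An injective edge-coloring of $G$ with $k$ colors is a map $c:E(G)\to\{1,\dots,k\}$ (not necessarily a proper edge-coloring) such that $c(e_1)\neq c(e_3)$ whenever $e_1,e_2,e_3$ are consecutive edges in $G$. The injective chromatic index $\chi'_{\mathrm{inj}}(G)$ is the minimum $k$ such that $G$ has an injective edge-coloring with $k$ colors. -}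

module Defs where

open import Data.Fin using (Fin)
open import Data.List using ([]; _∷_)
open import Data.List.Relation.Unary.Unique.Propositional using (Unique)
open import Data.Nat using (ℕ; _≤_)
open import Data.Product using (Σ-syntax; ∃-syntax; _×_; _,_)
open import Data.Refinement using (Refinement; value)
open import Data.Sum using (_⊎_; inj₁; inj₂)
open import Function using (_on_)
open import Function.Bundles using (Func)
open import Level using (0ℓ)
open import Relation.Binary using (Rel; Setoid; Symmetric; Decidable)
open import Relation.Binary.Construct.Closure.ReflexiveTransitive using ()
  renaming (Star to ReflTransClosure)
open import Relation.Binary.PropositionalEquality
  using (_≡_; _≢_; refl; setoid)
open import Relation.Nullary using (¬_)
open import Relation.Unary using (Pred; _∪_)

record Graph (V : Set) : Set₁ where
  field
    Adj      : Rel V 0ℓ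
    symm     : Symmetric Adj
    loopless : ∀ {v} → ¬ Adj v v

-- Decidability of adjacency is the constructive form of the graph being given
-- by finite data; classically it is no restriction.
record FiniteGraph : Set₁ where
  field
    order : ℕ
    graph : Graph (Fin order)
    adj?  : Decidable (Graph.Adj graph)

-- Membership proofs in a Refinement are irrelevant, so each vertex satisfying P
-- occurs exactly once, even when P (such as Connected below) has many proofs.
induced : ∀ {V} → Graph V → (P : Pred V 0ℓ) → Graph (Refinement V P)
induced G P = record
  { Adj      = Graph.Adj G on value
  ; symm     = Graph.symm G
  ; loopless = Graph.loopless G
  }

Connected : ∀ {V} → Graph V → Rel V 0ℓ
Connected G = ReflTransClosure (Graph.Adj G)

component : ∀ {V} (G : Graph V) (v : V) → Graph (Refinement V (Connected G v))
component G v = induced G (Connected G v)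

-- G is K₁,ₘ for some m ≥ 0, with centre x; a single vertex is a star.
IsStar : ∀ {V} → Graph V → Set
IsStar {V} G = ∃[ x ] (∀ y → y ≢ x → Adj x y)
                    × (∀ y z → y ≢ x → z ≢ x → ¬ Adj y z)
  where open Graph G

IsStarForest : ∀ {V} → Graph V → Set
IsStarForest G = ∀ v → IsStar (component G v)

ColorClass : ∀ {V : Set} {k} → (V → Fin k) → Fin k → Pred V 0ℓ
ColorClass φ i v = φ v ≡ i

IsProper : ∀ {V k} → Graph V → (V → Fin k) → Set
IsProper G φ = ∀ u v → Graph.Adj G u v → φ u ≢ φ v

IsStarColoring : ∀ {V k} → Graph V → (V → Fin k) → Set
IsStarColoring G φ =
  IsProper G φ ×
  (∀ i j → i ≢ j → IsStarForest (induced G (ColorClass φ i ∪ ColorClass φ j)))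

-- An edge with an orientation and a proof of adjacency; both are forgotten by
-- the equality of edgeSetoid.
record Edge {V : Set} (G : Graph V) : Set where
  field
    source target : V
    adjacent      : Graph.Adj G source target

module _ {V : Set} {G : Graph V} where

  open Edge

  _Joins_,_ : Edge G → V → V → Set
  e Joins u , v = (source e ≡ u × target e ≡ v) ⊎ (source e ≡ v × target e ≡ u)

  _≈ₑ_ : Rel (Edge G) 0ℓ
  e ≈ₑ f = e Joins source f , target f

  data Consecutive (e₁ e₂ e₃ : Edge G) : Set where
    path  : ∀ a b c d → Unique (a ∷ b ∷ c ∷ d ∷ []) →
            e₁ Joins a , b → e₂ Joins b , c → e₃ Joins c , d →
            Consecutive e₁ e₂ e₃
    cycle : ∀ a b c → Unique (a ∷ b ∷ c ∷ []) →
            e₁ Joins a , b → e₂ Joins b , c → e₃ Joins c , a →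
            Consecutive e₁ e₂ e₃

edgeSetoid : ∀ {V} → Graph V → Setoid 0ℓ 0ℓ
edgeSetoid G = record
  { Carrier       = Edge G
  ; _≈_           = _≈ₑ_
  ; isEquivalence = record
    { refl  = inj₁ (refl , refl)
    ; sym   = λ where
        (inj₁ (refl , refl)) → inj₁ (refl , refl)
        (inj₂ (refl , refl)) → inj₂ (refl , refl)
    ; trans = λ where
        (inj₁ (refl , refl)) q                    → q
        (inj₂ (refl , refl)) (inj₁ (refl , refl)) → inj₂ (refl , refl)
        (inj₂ (refl , refl)) (inj₂ (refl , refl)) → inj₁ (refl , refl)
    }
  }

EdgeColoring : ∀ {V} → Graph V → ℕ → Set
EdgeColoring G k = Func (edgeSetoid G) (setoid (Fin k))

IsInjectiveEdgeColoring : ∀ {V k} (G : Graph V) → EdgeColoring G k → Set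
IsInjectiveEdgeColoring G c =
  ∀ e₁ e₂ e₃ → Consecutive {G = G} e₁ e₂ e₃ → Func.to c e₁ ≢ Func.to c e₃

IsLeast : Pred ℕ 0ℓ → Pred ℕ 0ℓ
IsLeast P k = P k × (∀ m → P m → k ≤ m)

module _ (G : FiniteGraph) where

  open FiniteGraph G

  StarColorable : Pred ℕ 0ℓ
  StarColorable k = Σ[ φ ∈ (Fin order → Fin k) ] IsStarColoring graph φ

  IsStarChromaticNumber : Pred ℕ 0ℓ
  IsStarChromaticNumber = IsLeast StarColorable

  InjectivelyEdgeColorable : Pred ℕ 0ℓ
  InjectivelyEdgeColorable k =
    Σ[ c ∈ EdgeColoring graph k ] IsInjectiveEdgeColoring graph c

  IsInjectiveChromaticIndex : Pred ℕ 0ℓ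
  IsInjectiveChromaticIndex = IsLeast InjectivelyEdgeColorable

{-# OPTIONS --safe #-}

-- Colour each edge by the unordered pair of star colours of its endpoints: if
-- a – b – c – d are consecutive edges whose outer edges received the same pair,
-- then φ a ≡ φ c and φ b ≡ φ d, so a, b, c, d lie in one component of the graph
-- induced by two colour classes, which would not be a star.  There are k(k−1)/2
-- pairs.  The least number of colours exists because injective
-- m-edge-colourability is decidable by search through all colour matrices.

module Submission where

open import Defs
open import Data.Empty.Irrelevant using (⊥-elim)
open import Data.Fin using (Fin; zero; suc; _↑ˡ_; _↑ʳ_; combine; remQuot; splitAt; finToFun; funToFin; _≟_)
open import Data.Fin.Properties
  using (all?; any?; ↑ˡ-injective; ↑ʳ-injective; splitAt-↑ˡ; splitAt-↑ʳ; remQuot-combine; finToFun-funToFin)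
open import Data.Irrelevant using ([_])
open import Data.List.Relation.Unary.All using ([]; _∷_)
open import Data.List.Relation.Unary.AllPairs using ([]; _∷_)
open import Data.Nat using (ℕ; zero; suc; _+_; _*_; _∸_; _^_; _≤_; z≤n; s≤s)
open import Data.Nat.DivMod using (_/_; m*n/n≡m)
open import Data.Nat.Properties using (*-distribʳ-+)
open import Data.Nat.Solver using (module +-*-Solver)
open import Data.Product using (∃-syntax; _×_; _,_; uncurry)
open import Data.Refinement using (value; _,_)
open import Data.Sum using (_⊎_; inj₁; inj₂; map)
open import Function.Base using (_∘_)
open import Function.Bundles using (Func)
open import Level using (0ℓ)
open import Relation.Binary.Construct.Closure.ReflexiveTransitive using (ε; _◅_; _◅◅_)
open import Relation.Binary.PropositionalEquality
  using (_≡_; _≢_; refl; sym; trans; cong; subst; module ≡-Reasoning)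
open import Relation.Nullary using (Dec; yes; no; ¬?; contradiction; _×-dec_; _→-dec_)
open import Relation.Nullary.Decidable using (map′)
open import Relation.Unary using (Pred; Decidable)

-- The given witness bounds an upward search: if `P 0` fails, the least element of the shifted
-- predicate `P ∘ suc` is one below that of `P`.
least : ∀ {P : Pred ℕ 0ℓ} → Decidable P → ∀ n → P n → ∃[ m ] (IsLeast P m × m ≤ n)
least P? zero    p = 0 , (p , λ _ _ → z≤n) , z≤n
least P? (suc n) p with P? 0
... | yes p₀ = 0 , (p₀ , λ _ _ → z≤n) , z≤n
... | no ¬p₀ with least (P? ∘ suc) n p
...   | m , (pm , minimal) , m≤n =
  suc m , (pm , λ { zero q → contradiction q ¬p₀ ; (suc j) q → s≤s (minimal j q) }) , s≤s m≤n

-- Numbering the unordered pairs of distinct colours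

pairs : ℕ → ℕ
pairs zero    = 0
pairs (suc k) = k + pairs k

pairs*2 : ∀ k → pairs k * 2 ≡ k * (k ∸ 1)
pairs*2 zero          = refl
-- One is split off so that the truncated subtraction in the induction hypothesis reduces.
pairs*2 (suc zero)    = refl
pairs*2 (suc (suc k)) = begin
  (suc k + pairs (suc k)) * 2     ≡⟨ *-distribʳ-+ 2 (suc k) (pairs (suc k)) ⟩
  suc k * 2 + pairs (suc k) * 2   ≡⟨ cong (suc k * 2 +_) (pairs*2 (suc k)) ⟩
  suc k * 2 + suc k * k           ≡⟨ solve 1 (λ n → (con 1 :+ n) :* con 2 :+ (con 1 :+ n) :* n
                                        := (con 2 :+ n) :* (con 1 :+ n)) refl k ⟩
  suc (suc k) * suc k             ∎
  where
  open ≡-Reasoning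
  open +-*-Solver

pairs≡k*[k∸1]/2 : ∀ k → pairs k ≡ k * (k ∸ 1) / 2
pairs≡k*[k∸1]/2 k = trans (sym (m*n/n≡m (pairs k) 2)) (cong (_/ 2) (pairs*2 k))

-- Of the `k + pairs k` numbers, the first `k` stand for the pairs containing `zero`, indexed by the
-- other element; the rest are numbered recursively. Since the proof of `i ≢ j` is irrelevant, an
-- edge colour built from `pair` cannot depend on the proof of adjacency.
pair : ∀ {k} (i j : Fin k) → .(i ≢ j) → Fin (pairs k)
pair         zero    zero    i≢j = ⊥-elim (i≢j refl)
pair {suc k} zero    (suc j) _   = j ↑ˡ pairs k
pair {suc k} (suc i) zero    _   = i ↑ˡ pairs k
pair {suc k} (suc i) (suc j) i≢j = k ↑ʳ pair i j (i≢j ∘ cong suc)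

pair-comm : ∀ {k} (i j : Fin k) .(p : i ≢ j) .(q : j ≢ i) → pair i j p ≡ pair j i q
pair-comm         zero    zero    p q = ⊥-elim (p refl)
pair-comm         zero    (suc j) p q = refl
pair-comm         (suc i) zero    p q = refl
pair-comm {suc k} (suc i) (suc j) p q = cong (k ↑ʳ_) (pair-comm i j _ _)

↑ˡ≢↑ʳ : ∀ {m n} (i : Fin m) (j : Fin n) → i ↑ˡ n ≢ m ↑ʳ j
↑ˡ≢↑ʳ {m} {n} i j eq
  with () ← trans (sym (splitAt-↑ˡ m i n)) (trans (cong (splitAt m) eq) (splitAt-↑ʳ m n j))

-- The block containing the number tells whether `zero` occurs in the pair, which excludes the mixed
-- cases. If it occurs, the index recovers the other element; if not, induction applies.
pair-injective : ∀ {k} (i j i′ j′ : Fin k) .(p : i ≢ j) .(q : i′ ≢ j′) →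
                 pair i j p ≡ pair i′ j′ q → (i ≡ i′ × j ≡ j′) ⊎ (i ≡ j′ × j ≡ i′)
pair-injective zero    zero    _        _        p q eq = ⊥-elim (p refl)
pair-injective _       _       zero     zero     p q eq = ⊥-elim (q refl)
pair-injective zero    (suc j) zero     (suc j′) p q eq = inj₁ (refl , cong suc (↑ˡ-injective _ j j′ eq))
pair-injective zero    (suc j) (suc i′) zero     p q eq = inj₂ (refl , cong suc (↑ˡ-injective _ j i′ eq))
pair-injective (suc i) zero    zero     (suc j′) p q eq = inj₂ (cong suc (↑ˡ-injective _ i j′ eq) , refl)
pair-injective (suc i) zero    (suc i′) zero     p q eq = inj₁ (cong suc (↑ˡ-injective _ i i′ eq) , refl)
pair-injective zero    (suc j) (suc i′) (suc j′) p q eq = contradiction eq (↑ˡ≢↑ʳ j _)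
pair-injective (suc i) zero    (suc i′) (suc j′) p q eq = contradiction eq (↑ˡ≢↑ʳ i _)
pair-injective (suc i) (suc j) zero     (suc j′) p q eq = contradiction (sym eq) (↑ˡ≢↑ʳ j′ _)
pair-injective (suc i) (suc j) (suc i′) zero     p q eq = contradiction (sym eq) (↑ˡ≢↑ʳ i′ _)
pair-injective {suc k} (suc i) (suc j) (suc i′) (suc j′) p q eq =
  map sucs sucs (pair-injective i j i′ j′ _ _ (↑ʳ-injective k _ _ eq))
  where
  sucs : ∀ {a b c d : Fin k} → a ≡ b × c ≡ d → suc a ≡ suc b × suc c ≡ suc d
  sucs (refl , refl) = refl , refl

-- A matrix has `n * n` entries, so it is coded by a number below `m ^ (n * n)`. Decoding returns
-- the matrix only up to pointwise equality, hence the condition that `P` respects it.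
any-matrix? : ∀ n m {P : Pred (Fin n → Fin n → Fin m) 0ℓ} → Decidable P →
              (∀ {f g} → (∀ u v → f u v ≡ g u v) → P f → P g) → Dec (∃[ f ] P f)
any-matrix? n m {P} P? resp = map′
  (λ (i , p) → matrix i , p)
  (λ (f , p) → code f , resp (λ u v → sym (matrix-code f u v)) p)
  (any? (P? ∘ matrix))
  where
  matrix : Fin (m ^ (n * n)) → Fin n → Fin n → Fin m
  matrix i u v = finToFun i (combine u v)

  code : (Fin n → Fin n → Fin m) → Fin (m ^ (n * n))
  code f = funToFin (uncurry f ∘ remQuot n)

  matrix-code : ∀ f u v → matrix (code f) u v ≡ f u v
  matrix-code f u v = trans (finToFun-funToFin _ (combine u v)) (cong (uncurry f) (remQuot-combine u v))

-- Star colourings yield injective edge-colourings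

module _ {n} (G : Graph (Fin n)) where

  open Graph G
  open Edge

  -- A path or a triangle (d ≡ a) with edges ab, bc, cd; the remaining
  -- inequalities follow from adjacency.
  Trail : (a b c d : Fin n) → Set
  Trail a b c d = Adj a b × Adj b c × Adj c d × a ≢ c × b ≢ d

  joins-adj : ∀ (e : Edge G) {u v} → e Joins u , v → Adj u v
  joins-adj e (inj₁ (refl , refl)) = adjacent e
  joins-adj e (inj₂ (refl , refl)) = symm (adjacent e)

  trail : ∀ {e₁ e₂ e₃ : Edge G} → Consecutive e₁ e₂ e₃ →
          ∃[ a ] ∃[ b ] ∃[ c ] ∃[ d ] (Trail a b c d × e₁ Joins a , b × e₃ Joins c , d)
  trail {e₁} {e₂} {e₃}
        (path a b c d ((_ ∷ a≢c ∷ _) ∷ (_ ∷ b≢d ∷ _) ∷ _) j₁ j₂ j₃) =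
    a , b , c , d , (joins-adj e₁ j₁ , joins-adj e₂ j₂ , joins-adj e₃ j₃ , a≢c , b≢d) , j₁ , j₃
  trail {e₁} {e₂} {e₃}
        (cycle a b c ((a≢b ∷ a≢c ∷ _) ∷ _) j₁ j₂ j₃) =
    a , b , c , a , (joins-adj e₁ j₁ , joins-adj e₂ j₂ , joins-adj e₃ j₃ , a≢c , a≢b ∘ sym) , j₁ , j₃

  adj⇒≢ : ∀ {u v} → Adj u v → u ≢ v
  adj⇒≢ uv refl = loopless uv

  edge : ∀ {u v} → Adj u v → Edge G
  edge uv = record { adjacent = uv }

  -- Converse to `trail`: whether `a ≡ d` decides between triangle and path.
  trail-consecutive : ∀ {a b c d} (ab : Adj a b) (bc : Adj b c) (cd : Adj c d) →
                      a ≢ c → b ≢ d → Consecutive (edge ab) (edge bc) (edge cd)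
  trail-consecutive {a} {b} {c} {d} ab bc cd a≢c b≢d with a ≟ d
  ... | yes refl = cycle a b c ((adj⇒≢ ab ∷ a≢c ∷ []) ∷ (adj⇒≢ bc ∷ []) ∷ [] ∷ [])
                     (inj₁ (refl , refl)) (inj₁ (refl , refl)) (inj₁ (refl , refl))
  ... | no a≢d = path a b c d
                   ((adj⇒≢ ab ∷ a≢c ∷ a≢d ∷ []) ∷ (adj⇒≢ bc ∷ b≢d ∷ []) ∷ (adj⇒≢ cd ∷ []) ∷ [] ∷ [])
                   (inj₁ (refl , refl)) (inj₁ (refl , refl)) (inj₁ (refl , refl))

  -- Otherwise the whole trail lies in the component of `a` in the graph induced by the colours
  -- `φ a` and `φ b`. The centre of a star lies on each of its edges, but a centre off `a` and `b`
  -- misses `ab`, the centre `a` misses `bc`, and the centre `b` misses `cd`. This covers the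
  -- triangle too.
  star-no-trail : ∀ {k} {φ : Fin n → Fin k} → IsStarColoring G φ →
                  ∀ {a b c d} → Trail a b c d → φ a ≡ φ c → φ b ≢ φ d
  star-no-trail {φ = φ} (proper , forest) {a} {b} {c} {d} (ab , bc , cd , a≢c , b≢d) φa≡φc φb≡φd
    with forest (φ a) (φ b) (proper a b ab) (a , [ inj₁ refl ])
  ... | x , _ , independent = centre (value (value x) ≟ a) (value (value x) ≟ b)
    where
    b′ = b , [ inj₂ refl ]
    c′ = c , [ inj₁ (sym φa≡φc) ]
    d′ = d , [ inj₂ (sym φb≡φd) ]

    bc′ : Connected (induced G _) b′ c′
    bc′ = bc ◅ ε

    cd′ : Connected (induced G _) c′ d′
    cd′ = cd ◅ ε

    A = (a , [ inj₁ refl ]) , [ ε ]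
    B = b′ , [ ab ◅ ε ]
    C = c′ , [ ab ◅ bc′ ]
    D = d′ , [ ab ◅ bc′ ◅◅ cd′ ]

    off : ∀ {y} → value (value x) ≢ value (value y) → y ≢ x
    off x≢y refl = x≢y refl

    centre : Dec (value (value x) ≡ a) → Dec (value (value x) ≡ b) → _
    centre (no x≢a)  (no x≢b)  = independent A B (off x≢a) (off x≢b) ab
    centre (yes x≡a) _         = independent B C
      (off λ x≡b → loopless (subst (Adj a) (trans (sym x≡b) x≡a) ab))
      (off λ x≡c → a≢c (trans (sym x≡a) x≡c)) bc
    centre _         (yes x≡b) = independent C D
      (off λ x≡c → loopless (subst (Adj b) (trans (sym x≡c) x≡b) bc))
      (off λ x≡d → b≢d (trans (sym x≡b) x≡d)) cd

  pair-coloring : ∀ {k} (φ : Fin n → Fin k) → IsProper G φ → EdgeColoring G (pairs k)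
  pair-coloring φ proper = record
    { to   = λ e → pair (φ (source e)) (φ (target e)) (proper _ _ (adjacent e))
    ; cong = λ where
        (inj₁ (refl , refl)) → refl
        {e} (inj₂ (refl , refl)) → pair-comm (φ (source e)) (φ (target e)) _ _
    }

  pair-coloring-injective : ∀ {k} (φ : Fin n → Fin k) (star@(proper , _) : IsStarColoring G φ) →
                            IsInjectiveEdgeColoring G (pair-coloring φ proper)
  pair-coloring-injective φ star@(proper , _) e₁ e₂ e₃ consecutive eq
    with a , b , c , d , t@(ab , bc , cd , _) , j₁ , j₃ ← trail consecutive
    with pair-injective (φ a) (φ b) (φ c) (φ d) _ _
           -- By definition `j₁` is a proof of `e₁ ≈ₑ edge ab`, so the outer edges may be replaced
           -- by their orientations along the trail.
           (trans (sym (χ.cong {e₁} {edge ab} j₁)) (trans eq (χ.cong {e₃} {edge cd} j₃)))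
    where module χ = Func (pair-coloring φ proper)
  ... | inj₁ (φa≡φc , φb≡φd) = star-no-trail star t φa≡φc φb≡φd
  ... | inj₂ (_     , φb≡φc) = proper b c bc φb≡φc

  -- A finitely enumerable stand-in for an edge-colouring: entries at non-adjacent pairs are
  -- constrained only by symmetry.
  IsColorMatrix : ∀ {m} → Pred (Fin n → Fin n → Fin m) 0ℓ
  IsColorMatrix f = (∀ u v → f u v ≡ f v u) × (∀ a b c d → Trail a b c d → f a b ≢ f c d)

  IsColorMatrix-resp : ∀ {m} {f g : Fin n → Fin n → Fin m} → (∀ u v → f u v ≡ g u v) →
                       IsColorMatrix f → IsColorMatrix g
  IsColorMatrix-resp f≗g (f-sym , f-inj) =
    (λ u v → trans (sym (f≗g u v)) (trans (f-sym u v) (f≗g v u))) ,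
    (λ a b c d t eq → f-inj a b c d t (trans (f≗g a b) (trans eq (sym (f≗g c d)))))

  fromMatrix : ∀ {m} {f : Fin n → Fin n → Fin m} → IsColorMatrix f →
               ∃[ χ ] IsInjectiveEdgeColoring {k = m} G χ
  fromMatrix {m} {f} (f-sym , f-inj) = χ , injective
    where
    χ : EdgeColoring G m
    χ = record
      { to   = λ e → f (source e) (target e)
      ; cong = λ where
          (inj₁ (refl , refl)) → refl
          {e} (inj₂ (refl , refl)) → f-sym (source e) (target e)
      }
    injective : IsInjectiveEdgeColoring G χ
    injective e₁ e₂ e₃ consecutive eq
      with a , b , c , d , t@(ab , _ , cd , _) , j₁ , j₃ ← trail consecutive =
      f-inj a b c d t (trans (sym (Func.cong χ {e₁} {edge ab} j₁))
                        (trans eq (Func.cong χ {e₃} {edge cd} j₃)))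

-- Deciding injective edge-colourability

module _ (G : FiniteGraph) where

  open FiniteGraph G
  open Graph graph

  Trail? : ∀ a b c d → Dec (Trail graph a b c d)
  Trail? a b c d = adj? a b ×-dec adj? b c ×-dec adj? c d ×-dec ¬? (a ≟ c) ×-dec ¬? (b ≟ d)

  IsColorMatrix? : ∀ {m} → Decidable (IsColorMatrix graph {m})
  IsColorMatrix? f =
    all? (λ u → all? λ v → f u v ≟ f v u) ×-dec
    all? (λ a → all? λ b → all? λ c → all? λ d → Trail? a b c d →-dec ¬? (f a b ≟ f c d))

  toMatrix : ∀ {m} → InjectivelyEdgeColorable G (suc m) → ∃[ f ] IsColorMatrix graph {suc m} f
  toMatrix {m} (χ , χ-inj) = f , f-sym , f-inj
    where
    entry : ∀ {u v} → Dec (Adj u v) → Fin (suc m)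
    entry (yes uv) = Func.to χ (edge graph uv)
    -- An arbitrary value for non-edges; it exists because there is at least one colour.
    entry (no _)   = zero

    f : Fin order → Fin order → Fin (suc m)
    f u v = entry (adj? u v)

    f-edge : ∀ {u v} (uv : Adj u v) → f u v ≡ Func.to χ (edge graph uv)
    f-edge {u} {v} uv with adj? u v
    -- The proof found by `adj?` may differ from `uv`, but `_≈ₑ_` forgets both.
    ... | yes _  = Func.cong χ (inj₁ (refl , refl))
    ... | no ¬uv = contradiction uv ¬uv

    f-sym : ∀ u v → f u v ≡ f v u
    f-sym u v with adj? u v | adj? v u
    ... | yes _  | yes _  = Func.cong χ (inj₂ (refl , refl))
    ... | yes uv | no ¬vu = contradiction (symm uv) ¬vu
    ... | no ¬uv | yes vu = contradiction (symm vu) ¬uv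
    ... | no _   | no _   = refl

    f-inj : ∀ a b c d → Trail graph a b c d → f a b ≢ f c d
    f-inj a b c d (ab , bc , cd , a≢c , b≢d) eq =
      χ-inj _ _ _ (trail-consecutive graph ab bc cd a≢c b≢d)
        (trans (sym (f-edge ab)) (trans eq (f-edge cd)))

  -- Zero colours are treated apart: an edgeless graph is then colourable,
  -- although it has no matrix with entries in Fin 0.
  injectivelyEdgeColorable? : Decidable (InjectivelyEdgeColorable G)
  injectivelyEdgeColorable? zero with any? (λ u → any? (adj? u))
  ... | yes (u , v , uv) = no λ (χ , _) → contradiction (Func.to χ (edge graph uv)) λ ()
  ... | no edgeless      = yes
    ( record { to = λ e → contradiction (_ , _ , Edge.adjacent e) edgeless
             ; cong = λ {e} _ → contradiction (_ , _ , Edge.adjacent e) edgeless }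
    , λ e _ _ _ _ → edgeless (_ , _ , Edge.adjacent e))
  injectivelyEdgeColorable? (suc m) =
    map′ (λ (_ , isMatrix) → fromMatrix graph isMatrix) toMatrix
      (any-matrix? order (suc m) IsColorMatrix? (IsColorMatrix-resp graph))

theorem1p6 : (G : FiniteGraph) (k : ℕ) → IsStarChromaticNumber G k →
    ∃[ m ] (IsInjectiveChromaticIndex G m × m ≤ k * (k ∸ 1) / 2)
theorem1p6 G k ((φ , star@(proper , _)) , _) =
  -- The pair colouring attains this bound, so the search for the least number of colours ends there
  -- at the latest.
  least (injectivelyEdgeColorable? G) (k * (k ∸ 1) / 2)
    (subst (InjectivelyEdgeColorable G) (pairs≡k*[k∸1]/2 k)
      (pair-coloring graph φ proper , pair-coloring-injective graph φ star))
  where open FiniteGraph G
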